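{- Let $n\ge2$. Let $A_1=\{1\text{ - }23\}$, $A_2=\{2\text{ - }31,23\text{ - }1\}$, $A_3=\{1\text{ - }32,13\text{ - }2\}$, $A_4=\{3\text{ - }12,31\text{ - }2\}$. For every choice of $p_i\in A_i$ ($i=1,2,3,4$), $|S_n(p_1,p_2,p_3,p_4)|=2$ and $$S_n(p_1,p_2,p_3,p_4)=\{\,n\,(n-1)\ldots 3\,2\,1,\ \ (n-1)\,(n-2)\ldots 3\,2\,1\,n\,\}.$$
   Context: $S_n$ is the set of permutations $\pi=\pi_1\pi_2\cdots\pi_n$ of $\{1,\dots,n\}$ (written in one-line notation). For $abc$ a permutation of $123$, the generalized pattern $a\text{ - }bc$ is contained in $\pi$ if there are indices $i<j$ with $j+1\le n$ such that $\pi_i\pi_j\pi_{j+1}$ is order-isomorphic to $abc$; the generalized pattern $ab\text{ - }c$ is contained in $\pi$ if there are indices $i,k$ with $i+1<k\le n$ such that $\pi_i\pi_{i+1}\pi_k$ is order-isomorphic to $abc$. $\pi$ avoids a pattern if it does not contain it. $S_n(p_1,\dots,p_m)$ is the set of $\pi\in S_n$ avoiding all of $p_1,\dots,p_m$. -}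

module Defs where

open import Level using (Level)
open import Data.Nat using (ℕ; suc; _<_)
open import Data.Fin using (Fin; toℕ)
import Data.Fin as Fin
open import Data.List using (List; []; _∷_; length; lookup; applyUpTo)
open import Data.List.Membership.Propositional using (_∈_)
open import Data.List.Relation.Binary.Permutation.Propositional using (_↭_)
open import Data.List.Relation.Unary.All using (All)
open import Data.List.Relation.Unary.Unique.Propositional using (Unique)
open import Data.Product using (_×_; ∃; ∃-syntax)
open import Data.Vec using (Vec; []; _∷_)
import Data.Vec as Vec
open import Function.Bundles using (_⇔_)
open import Relation.Binary.PropositionalEquality using (_≡_)
open import Relation.Nullary using (¬_)
open import Relation.Unary using (Pred; _≐_)

OrderIsomorphic : ∀ {k} → Vec ℕ k → Vec ℕ k → Set
OrderIsomorphic u v =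
  ∀ s t → (Vec.lookup u s < Vec.lookup u t) ⇔ (Vec.lookup v s < Vec.lookup v t)

-- The pattern a-bc is written  a ╌ b ⌢ c  and ab-c is written  a ⌢ b ╌ c :
-- letters joined by ⌢ must be matched by adjacent entries.  The letters are
-- meant to form a permutation of 123.

infix 5 _╌_⌢_ _⌢_╌_

data GeneralizedPattern : Set where
  _╌_⌢_ : (a b c : ℕ) → GeneralizedPattern
  _⌢_╌_ : (a b c : ℕ) → GeneralizedPattern

infix 4 _Contains_ _Avoids_

-- The position named j+1 (resp. i+1) stands for the successor of j (resp. i)
-- as a position of π, so its existence says that the successor is in range.

_Contains_ : List ℕ → GeneralizedPattern → Set
π Contains (a ╌ b ⌢ c) =
  ∃[ i ] ∃[ j ] ∃[ j+1 ]
    i Fin.< j × toℕ j+1 ≡ suc (toℕ j) ×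
    OrderIsomorphic (lookup π i ∷ lookup π j ∷ lookup π j+1 ∷ []) (a ∷ b ∷ c ∷ [])
π Contains (a ⌢ b ╌ c) =
  ∃[ i ] ∃[ i+1 ] ∃[ k ]
    toℕ i+1 ≡ suc (toℕ i) × i+1 Fin.< k ×
    OrderIsomorphic (lookup π i ∷ lookup π i+1 ∷ lookup π k ∷ []) (a ∷ b ∷ c ∷ [])

_Avoids_ : List ℕ → GeneralizedPattern → Set
π Avoids p = ¬ (π Contains p)

-- Permutations are in one-line notation: π is a rearrangement of 1, 2, …, n.

S : ℕ → List GeneralizedPattern → Pred (List ℕ) _
S n ps π = π ↭ applyUpTo suc n × All (π Avoids_) ps

A₁ A₂ A₃ A₄ : List GeneralizedPattern
A₁ = (1 ╌ 2 ⌢ 3) ∷ []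
A₂ = (2 ╌ 3 ⌢ 1) ∷ (2 ⌢ 3 ╌ 1) ∷ []
A₃ = (1 ╌ 3 ⌢ 2) ∷ (1 ⌢ 3 ╌ 2) ∷ []
A₄ = (3 ╌ 1 ⌢ 2) ∷ (3 ⌢ 1 ╌ 2) ∷ []

-- Cardinality of a finite subset of A, via an enumeration without repetition.

HasCardinality : ∀ {a ℓ : Level} {A : Set a} → Pred A ℓ → ℕ → Set _
HasCardinality P k = ∃ λ xs → length xs ≡ k × Unique xs × P ≐ (_∈ xs)

{-# OPTIONS --safe #-}

-- Avoiding p₁, p₂ and p₃ excludes 123, 132 and 231 as consecutive triples, so
-- π has no ascent except perhaps at its very end.  If there is one, avoiding p₄
-- forces the last entry to exceed all the others.  Conversely, in both
-- permutations any three entries, read from left to right, are in the relative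
-- order 321 or 213, which none of the patterns has.

module Submission where

open import Defs
open import Data.Empty using (⊥-elim)
open import Data.Fin using (Fin; suc; toℕ)
import Data.Fin as Fin
open import Data.Fin.Patterns using (0F; 1F; 2F)
open import Data.List using (List; []; _∷_; _++_; _∷ʳ_; applyDownFrom; applyUpTo; head; lookup)
open import Data.List.Membership.Propositional using (_∈_)
open import Data.List.Membership.Propositional.Properties using (∈-++⁺ʳ; ∈-lookup)
open import Data.List.Properties using (reverse-applyUpTo; ∷-injective)
open import Data.List.Relation.Binary.Equality.Propositional using (≋⇒≡)
open import Data.List.Relation.Binary.Permutation.Propositional
  using (_↭_; ↭-sym; ↭-trans; ↭-reflexive; ↭⇒↭ₛ; module PermutationReasoning)
open import Data.List.Relation.Binary.Permutation.Propositional.Properties using (↭-reverse; ∷↭∷ʳ)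
import Data.List.Relation.Binary.Permutation.Setoid.Properties as Permutation
open import Data.List.Relation.Unary.All as All using (All; []; _∷_)
open import Data.List.Relation.Unary.AllPairs as AllPairs using (AllPairs; []; _∷_)
import Data.List.Relation.Unary.AllPairs.Properties as AllPairs
open import Data.List.Relation.Unary.Any using (here; there; index)
open import Data.List.Relation.Unary.Any.Properties using (lookup-index)
open import Data.List.Relation.Unary.Linked as Linked using (Linked; []; [-]; _∷_; _∷′_)
import Data.List.Relation.Unary.Linked.Properties as Linked
open import Data.List.Relation.Unary.Sorted.TotalOrder.Properties using (↗↭↗⇒≋)
open import Data.List.Relation.Unary.Unique.Propositional using (Unique)
open import Data.Maybe using (just)
open import Data.Maybe.Relation.Binary.Connected using (Connected; just)
open import Data.Nat using (ℕ; suc; _∸_; _≤_; _<_; _>_; z≤n; s≤s; _<?_)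
open import Data.Nat.Properties
  using (<-cmp; <-trans; <-asym; <-irrefl; <⇒≤; >⇒≢; n<1+n; ≤-reflexive; ≤-totalOrder)
open import Data.Product using (_×_; _,_; ∃-syntax)
open import Data.Sum as Sum using (_⊎_; inj₁; inj₂)
open import Data.Vec as Vec using (Vec; []; _∷_)
open import Data.Vec.Properties using (lookup-map)
open import Function using (_∘_; const)
open import Function.Bundles using (mk⇔; module Equivalence)
import Relation.Binary.Construct.Flip.EqAndOrd as Flip
open import Relation.Binary.Definitions using (tri<; tri≈; tri>)
open import Relation.Binary.PropositionalEquality
  using (_≡_; _≢_; refl; sym; cong; subst; setoid)
open import Relation.Nullary using (¬_; contradiction)
open import Relation.Nullary.Decidable using (Dec; from-yes; ¬?; _×-dec_; _⊎-dec_)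
open import Relation.Unary using (_≐_)

open Equivalence using (to)

private
  variable
    x y z : ℕ
    xs ys π : List ℕ
    p : GeneralizedPattern

-- Order isomorphism and occurrences of patterns

increasing-≅-123 : x < y → y < z → OrderIsomorphic (x ∷ y ∷ z ∷ []) (1 ∷ 2 ∷ 3 ∷ [])
increasing-≅-123 {x} {y} {z} x<y y<z = λ where
    0F 0F → mk⇔ (⊥-elim ∘ <-irrefl refl) (⊥-elim ∘ <-irrefl refl)
    1F 1F → mk⇔ (⊥-elim ∘ <-irrefl refl) (⊥-elim ∘ <-irrefl refl)
    2F 2F → mk⇔ (⊥-elim ∘ <-irrefl refl) (⊥-elim ∘ <-irrefl refl)
    0F 1F → mk⇔ (const (from-yes (1 <? 2))) (const x<y)
    0F 2F → mk⇔ (const (from-yes (1 <? 3))) (const (<-trans x<y y<z))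
    1F 2F → mk⇔ (const (from-yes (2 <? 3))) (const y<z)
    1F 0F → mk⇔ (⊥-elim ∘ <-asym x<y) (⊥-elim ∘ <-asym (from-yes (1 <? 2)))
    2F 0F → mk⇔ (⊥-elim ∘ <-asym (<-trans x<y y<z)) (⊥-elim ∘ <-asym (from-yes (1 <? 3)))
    2F 1F → mk⇔ (⊥-elim ∘ <-asym y<z) (⊥-elim ∘ <-asym (from-yes (2 <? 3)))

reindex : ∀ {k} {u v : Vec ℕ k} → OrderIsomorphic u v → (σ : Vec (Fin k) k) →
          OrderIsomorphic (Vec.map (Vec.lookup u) σ) (Vec.map (Vec.lookup v) σ)
reindex {u = u} {v} u≅v σ s t
  rewrite lookup-map s (Vec.lookup u) σ | lookup-map t (Vec.lookup u) σ
        | lookup-map s (Vec.lookup v) σ | lookup-map t (Vec.lookup v) σ = u≅v _ _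

-- The one case 123 yields every relative order of three distinct entries: `x`, `y`, `z` are the
-- entries sorted by size, and `σ` lists their ranks in reading order, so `1F ∷ 2F ∷ 0F ∷ []` gives
-- 231.
increasing-≅ : x < y → y < z → (σ : Vec (Fin 3) 3) →
  OrderIsomorphic (Vec.map (Vec.lookup (x ∷ y ∷ z ∷ [])) σ)
                  (Vec.map (Vec.lookup (1 ∷ 2 ∷ 3 ∷ [])) σ)
increasing-≅ {x} {y} {z} x<y y<z =
  reindex {u = x ∷ y ∷ z ∷ []} {1 ∷ 2 ∷ 3 ∷ []} (increasing-≅-123 x<y y<z)

letters : GeneralizedPattern → Vec ℕ 3
letters (a ╌ b ⌢ c) = a ∷ b ∷ c ∷ []
letters (a ⌢ b ╌ c) = a ∷ b ∷ c ∷ []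

contains-tail : ∀ p → π Contains p → (x ∷ π) Contains p
contains-tail (_ ╌ _ ⌢ _) (i , j , j+1 , i<j , eq , iso) =
  suc i , suc j , suc j+1 , s≤s i<j , cong suc eq , iso
contains-tail (_ ⌢ _ ╌ _) (i , i+1 , k , eq , i+1<k , iso) =
  suc i , suc i+1 , suc k , cong suc eq , s≤s i+1<k , iso

-- Three adjacent entries meet the adjacency condition of either kind of pattern, so the choice of
-- dash in `A₂` and `A₃` is immaterial.
contains-consecutive : ∀ p {u} → letters p ≡ u → OrderIsomorphic (x ∷ y ∷ z ∷ []) u →
                       (x ∷ y ∷ z ∷ π) Contains p
contains-consecutive (_ ╌ _ ⌢ _) refl iso = 0F , 1F , 2F , s≤s z≤n , refl , iso
contains-consecutive (_ ⌢ _ ╌ _) refl iso = 0F , 1F , 2F , refl , s≤s (s≤s z≤n) , iso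

-- Adjacency is weakened to an inequality of positions. This puts both kinds of pattern in one form,
-- enough for showing avoidance.
occurrence : ∀ p → π Contains p →
  ∃[ i ] ∃[ j ] ∃[ k ] i Fin.< j × j Fin.< k ×
    OrderIsomorphic (lookup π i ∷ lookup π j ∷ lookup π k ∷ []) (letters p)
occurrence (_ ╌ _ ⌢ _) (i , j , j+1 , i<j , eq , iso) =
  i , j , j+1 , i<j , ≤-reflexive (sym eq) , iso
occurrence (_ ⌢ _ ╌ _) (i , i+1 , k , eq , i+1<k , iso) =
  i , i+1 , k , ≤-reflexive (sym eq) , i+1<k , iso

A₁-letters : All (λ p → letters p ≡ 1 ∷ 2 ∷ 3 ∷ []) A₁
A₁-letters = refl ∷ []

A₂-letters : All (λ p → letters p ≡ 2 ∷ 3 ∷ 1 ∷ []) A₂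
A₂-letters = refl ∷ refl ∷ []

A₃-letters : All (λ p → letters p ≡ 1 ∷ 3 ∷ 2 ∷ []) A₃
A₃-letters = refl ∷ refl ∷ []

-- Descending lists

Descending : List ℕ → Set
Descending = Linked _>_

descending⇒allPairs : Descending xs → AllPairs _>_ xs
descending⇒allPairs = Linked.Linked⇒AllPairs (λ x>y y>z → <-trans y>z x>y)

applyDownFrom-descending : ∀ n → Descending (applyDownFrom suc n)
applyDownFrom-descending n = Linked.applyDownFrom⁺₂ suc n (λ i → n<1+n (suc i))

-- Descending lists are sorted for the flipped order, and two sorted rearrangements of each other
-- coincide.
descending-↭⇒≡ : Descending xs → Descending ys → xs ↭ ys → xs ≡ ys
descending-↭⇒≡ xs↘ ys↘ xs↭ys =
  ≋⇒≡ (↗↭↗⇒≋ (Flip.totalOrder ≤-totalOrder) (Linked.map <⇒≤ xs↘) (Linked.map <⇒≤ ys↘) (↭⇒↭ₛ xs↭ys))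

applyUpTo↭applyDownFrom : ∀ (f : ℕ → ℕ) n → applyUpTo f n ↭ applyDownFrom f n
applyUpTo↭applyDownFrom f n =
  ↭-trans (↭-sym (↭-reverse (applyUpTo f n))) (↭-reflexive (reverse-applyUpTo f n))

permutation-unique : ∀ n → π ↭ applyUpTo suc n → Unique π
permutation-unique n π↭ =
  Permutation.Unique-resp-↭ (setoid ℕ)
    (↭⇒↭ₛ (↭-sym (↭-trans π↭ (applyUpTo↭applyDownFrom suc n))))
    (AllPairs.map >⇒≢ (descending⇒allPairs (applyDownFrom-descending n)))

-- The shape of the avoiding permutations

-- In `last-max` the last entry is moved to the front, so that a single descending list records both
-- that `z` is the maximum and that the entries before it descend.
data Shape : List ℕ → Set where
  descending : Descending π → Shape π
  last-max   : Descending (z ∷ y ∷ ys) → Shape ((y ∷ ys) ∷ʳ z)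

final-ascent : Descending (z ∷ y ∷ ys) → let π = (y ∷ ys) ∷ʳ z in
  ∃[ j ] ∃[ j+1 ] toℕ j+1 ≡ suc (toℕ j) × lookup π j < lookup π j+1 × lookup π j+1 ≡ z
final-ascent (z>y ∷ [-])       = 0F , 1F , refl , z>y , refl
final-ascent (z>y ∷ y>y′ ∷ ys↘) with final-ascent (<-trans y>y′ z>y ∷ ys↘)
... | j , j+1 , eq , asc , last = suc j , suc j+1 , cong suc eq , asc , last

-- The two members of `A₄` need different occurrences. For 3-12, `x` is followed by the final
-- ascent; for 31-2, the adjacent entries `x` and `y` are followed by the last entry `z`.
contains-A₄ : z < x → Descending (z ∷ y ∷ ys) → p ∈ A₄ → (x ∷ (y ∷ ys) ∷ʳ z) Contains p
contains-A₄ {x = x} z<x zys↘ (here refl) with final-ascent zys↘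
... | j , j+1 , eq , asc , last =
  0F , suc j , suc j+1 , s≤s z≤n , cong suc eq ,
  increasing-≅ asc (subst (_< x) (sym last) z<x) (2F ∷ 0F ∷ 1F ∷ [])
contains-A₄ {z} {x} {y} {ys} z<x (z>y ∷ _) (there (here refl)) =
  -- The position of `z` is read off a membership proof in `ys ∷ʳ z`, then shifted by two past `x`
  -- and `y`.
  0F , 1F , suc (suc (index z∈)) , refl , s≤s (s≤s z≤n) ,
  increasing-≅ (subst (y <_) last z>y) (subst (_< x) last z<x) (2F ∷ 0F ∷ 1F ∷ [])
  where
  z∈ : z ∈ ys ∷ʳ z
  z∈ = ∈-++⁺ʳ ys (here refl)
  last : z ≡ lookup (ys ∷ʳ z) (index z∈)
  last = lookup-index z∈

shape-∷ : Connected _>_ (just x) (head π) → All (x ≢_) π → p ∈ A₄ → (x ∷ π) Avoids p →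
          Shape π → Shape (x ∷ π)
shape-∷ x>π _ _ _ (descending π↘) = descending (x>π ∷′ π↘)
shape-∷ {x} (just x>y) x≢π p∈ av (last-max {z} {ys = ys} (z>y ∷ ys↘)) with <-cmp x z
... | tri< x<z _ _ = last-max (x<z ∷ x>y ∷ ys↘)
... | tri≈ _ x≡z _ = contradiction x≡z (All.lookup x≢π (there (∈-++⁺ʳ ys (here refl))))
-- Only here is `p₄` used: it forbids a new front entry above the final maximum.
... | tri> _ _ z<x = contradiction (contains-A₄ z<x (z>y ∷ ys↘) p∈) av

module _ {p₁ p₂ p₃ p₄ : GeneralizedPattern}
         (p₁∈ : p₁ ∈ A₁) (p₂∈ : p₂ ∈ A₂) (p₃∈ : p₃ ∈ A₃) (p₄∈ : p₄ ∈ A₄) where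

  private
    ps : List GeneralizedPattern
    ps = p₁ ∷ p₂ ∷ p₃ ∷ p₄ ∷ []

  initial-descent : Unique (x ∷ y ∷ z ∷ π) → All ((x ∷ y ∷ z ∷ π) Avoids_) ps → x > y
  initial-descent {x} {y} {z} ((x≢y ∷ x≢z ∷ _) ∷ (y≢z ∷ _) ∷ _) (av₁ ∷ av₂ ∷ av₃ ∷ _)
    with <-cmp x y
  ... | tri> _ _ y<x = y<x
  ... | tri≈ _ x≡y _ = contradiction x≡y x≢y
  -- After an ascent `x < y`, the third entry lies above `y`, below `x` or between them, giving 123,
  -- 231 or 132.
  ... | tri< x<y _ _ with <-cmp x z | <-cmp y z
  ...   | tri≈ _ x≡z _ | _            = contradiction x≡z x≢z
  ...   | _            | tri≈ _ y≡z _ = contradiction y≡z y≢z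
  ...   | _            | tri< y<z _ _ = contradiction
    (contains-consecutive p₁ (All.lookup A₁-letters p₁∈)
      (increasing-≅-123 x<y y<z)) av₁
  ...   | tri> _ _ z<x | tri> _ _ _   = contradiction
    (contains-consecutive p₂ (All.lookup A₂-letters p₂∈)
      (increasing-≅ z<x x<y (1F ∷ 2F ∷ 0F ∷ []))) av₂
  ...   | tri< x<z _ _ | tri> _ _ z<y = contradiction
    (contains-consecutive p₃ (All.lookup A₃-letters p₃∈)
      (increasing-≅ x<z z<y (0F ∷ 2F ∷ 1F ∷ []))) av₃

  avoiding-shape : ∀ π → Unique π → All (π Avoids_) ps → Shape π
  avoiding-shape []          _ _ = descending []
  avoiding-shape (x ∷ [])    _ _ = descending [-]
  avoiding-shape (x ∷ y ∷ []) ((x≢y ∷ _) ∷ _) _ with <-cmp x y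
  -- The only ascent that survives: no third entry follows it, so `initial-descent` does not apply.
  ... | tri< x<y _ _ = last-max (x<y ∷ [-])
  ... | tri≈ _ x≡y _ = contradiction x≡y x≢y
  ... | tri> _ _ y<x = descending (y<x ∷ [-])
  avoiding-shape (x ∷ π@(_ ∷ _ ∷ _)) u@(x≢π ∷ uπ) av@(_ ∷ _ ∷ _ ∷ av₄ ∷ []) =
    shape-∷ (just (initial-descent u av)) x≢π p₄∈ av₄
      (avoiding-shape π uπ (All.map (λ {p} av-p → av-p ∘ contains-tail p) av))

shape-permutation : ∀ n → Shape π → π ↭ applyUpTo suc (suc n) →
  π ∈ applyDownFrom suc (suc n) ∷ (applyDownFrom suc n ++ suc n ∷ []) ∷ []
shape-permutation n (descending π↘) π↭ =
  here (descending-↭⇒≡ π↘ (applyDownFrom-descending (suc n))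
    (↭-trans π↭ (applyUpTo↭applyDownFrom suc (suc n))))
shape-permutation n (last-max {z} {y} {ys} zys↘) π↭
  -- Moving `z` back to the front gives a descending rearrangement of 1, ..., n+1. Its head must be
  -- n+1 and its tail n, ..., 1.
  with ∷-injective (descending-↭⇒≡ zys↘ (applyDownFrom-descending (suc n)) (begin
    z ∷ y ∷ ys                   ↭⟨ ∷↭∷ʳ z (y ∷ ys) ⟩
    (y ∷ ys) ∷ʳ z                ↭⟨ π↭ ⟩
    applyUpTo suc (suc n)        ↭⟨ applyUpTo↭applyDownFrom suc (suc n) ⟩
    applyDownFrom suc (suc n)    ∎))
  where open PermutationReasoning
... | refl , eq = there (here (cong (_∷ʳ z) eq))

-- Lists all of whose triples are in the relative order 321 or 213

-- Both orders begin with a descent; they differ in whether the third entry is below both others or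
-- above both. Only strict comparisons occur, so an order isomorphism transports each of them.
Is321Or213 : Vec ℕ 3 → Set
Is321Or213 (x ∷ y ∷ z ∷ []) = y < x × (z < y ⊎ x < z)

is321Or213? : ∀ u → Dec (Is321Or213 u)
is321Or213? (x ∷ y ∷ z ∷ []) = (y <? x) ×-dec ((z <? y) ⊎-dec (x <? z))

is321Or213-resp : ∀ u v → OrderIsomorphic u v → Is321Or213 u → Is321Or213 v
is321Or213-resp (_ ∷ _ ∷ _ ∷ []) (_ ∷ _ ∷ _ ∷ []) u≅v (y<x , z) =
  to (u≅v 1F 0F) y<x , Sum.map (to (u≅v 2F 1F)) (to (u≅v 0F 2F)) z

data AllTriples321Or213 : List ℕ → Set where
  []  : AllTriples321Or213 []
  _∷_ : AllPairs (λ y z → Is321Or213 (x ∷ y ∷ z ∷ [])) π → AllTriples321Or213 π →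
        AllTriples321Or213 (x ∷ π)

allPairs-lookup : ∀ {a ℓ} {A : Set a} {R : A → A → Set ℓ} {xs : List A} → AllPairs R xs →
                  ∀ {i j} → i Fin.< j → R (lookup xs i) (lookup xs j)
allPairs-lookup (Rx ∷ _)  {0F}    {suc j} _         = All.lookup Rx (∈-lookup j)
allPairs-lookup (_ ∷ Rxs) {suc i} {suc j} (s≤s i<j) = allPairs-lookup Rxs i<j

allTriples-lookup : AllTriples321Or213 π → ∀ {i j k} → i Fin.< j → j Fin.< k →
                    Is321Or213 (lookup π i ∷ lookup π j ∷ lookup π k ∷ [])
allTriples-lookup (Rx ∷ _) {0F}    {suc _} {suc _} _         (s≤s j<k) = allPairs-lookup Rx j<k
allTriples-lookup (_ ∷ Rπ) {suc _} {suc _} {suc _} (s≤s i<j) (s≤s j<k) = allTriples-lookup Rπ i<j j<k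

-- An occurrence of `p` would carry the relative order of its three entries over to the letters of
-- `p`.
allTriples⇒avoids : AllTriples321Or213 π → ¬ Is321Or213 (letters p) → π Avoids p
allTriples⇒avoids {p = p} Rπ ¬p c with occurrence p c
... | i , j , k , i<j , j<k , iso = ¬p (is321Or213-resp _ (letters p) iso (allTriples-lookup Rπ i<j j<k))

allPairs-321 : All (x >_) xs → AllPairs _>_ xs → AllPairs (λ y z → Is321Or213 (x ∷ y ∷ z ∷ [])) xs
allPairs-321 []           []           = []
allPairs-321 (x>y ∷ x>ys) (y>ys ∷ ys↘) = All.map (λ y>z → x>y , inj₁ y>z) y>ys ∷ allPairs-321 x>ys ys↘

allTriples-descending : AllPairs _>_ xs → AllTriples321Or213 xs
allTriples-descending []            = []
allTriples-descending (x>xs ∷ xs↘) = allPairs-321 x>xs xs↘ ∷ allTriples-descending xs↘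

allTriples-∷ʳ : All (z >_) xs → AllPairs _>_ xs → AllTriples321Or213 (xs ∷ʳ z)
allTriples-∷ʳ []           []           = [] ∷ []
allTriples-∷ʳ (z>x ∷ z>xs) (x>xs ∷ xs↘) =
  -- Pairs following `x` split in two: both entries in `xs` give 321, and an entry of `xs` followed
  -- by `z` gives 213.
  AllPairs.++⁺ (allPairs-321 x>xs xs↘) ([] ∷ []) (All.map (λ x>y → (x>y , inj₂ z>x) ∷ []) x>xs)
  ∷ allTriples-∷ʳ z>xs xs↘

A₁-not-321Or213 : All (λ p → ¬ Is321Or213 (letters p)) A₁
A₁-not-321Or213 = from-yes (All.all? (λ p → ¬? (is321Or213? (letters p))) A₁)

A₂-not-321Or213 : All (λ p → ¬ Is321Or213 (letters p)) A₂
A₂-not-321Or213 = from-yes (All.all? (λ p → ¬? (is321Or213? (letters p))) A₂)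

A₃-not-321Or213 : All (λ p → ¬ Is321Or213 (letters p)) A₃
A₃-not-321Or213 = from-yes (All.all? (λ p → ¬? (is321Or213? (letters p))) A₃)

A₄-not-321Or213 : All (λ p → ¬ Is321Or213 (letters p)) A₄
A₄-not-321Or213 = from-yes (All.all? (λ p → ¬? (is321Or213? (letters p))) A₄)

proposition2p5 : ∀ (n : ℕ) → 2 ≤ n →
    ∀ (p₁ p₂ p₃ p₄ : GeneralizedPattern) →
    p₁ ∈ A₁ → p₂ ∈ A₂ → p₃ ∈ A₃ → p₄ ∈ A₄ →
    HasCardinality (S n (p₁ ∷ p₂ ∷ p₃ ∷ p₄ ∷ [])) 2 ×
    S n (p₁ ∷ p₂ ∷ p₃ ∷ p₄ ∷ []) ≐ (_∈ (applyDownFrom suc n ∷ (applyDownFrom suc (n ∸ 1) ++ n ∷ []) ∷ []))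
proposition2p5 n@(suc n-1@(suc _)) (s≤s _) p₁ p₂ p₃ p₄ p₁∈ p₂∈ p₃∈ p₄∈ =
  -- The two lists differ in their heads, `n` and `n-1`. This is where `2 ≤ n` matters: for n = 1
  -- the lists coincide.
  (_ , refl , ((λ ()) ∷ []) ∷ [] ∷ [] , S≐) , S≐
  where
  avoids-ps : AllTriples321Or213 π → All (π Avoids_) (p₁ ∷ p₂ ∷ p₃ ∷ p₄ ∷ [])
  avoids-ps Rπ =
      allTriples⇒avoids Rπ (All.lookup A₁-not-321Or213 p₁∈)
    ∷ allTriples⇒avoids Rπ (All.lookup A₂-not-321Or213 p₂∈)
    ∷ allTriples⇒avoids Rπ (All.lookup A₃-not-321Or213 p₃∈)
    ∷ allTriples⇒avoids Rπ (All.lookup A₄-not-321Or213 p₄∈)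
    ∷ []

  n↘ : AllPairs _>_ (applyDownFrom suc n)
  n↘ = descending⇒allPairs (applyDownFrom-descending n)

  n↭ : applyDownFrom suc n ↭ applyUpTo suc n
  n↭ = ↭-sym (applyUpTo↭applyDownFrom suc n)

  S≐ : S n (p₁ ∷ p₂ ∷ p₃ ∷ p₄ ∷ []) ≐
       (_∈ (applyDownFrom suc n ∷ (applyDownFrom suc (n ∸ 1) ++ n ∷ []) ∷ []))
  S≐ = (λ (π↭ , av) →
         shape-permutation n-1
           (avoiding-shape p₁∈ p₂∈ p₃∈ p₄∈ _ (permutation-unique n π↭) av) π↭)
     , λ where
         (here refl)         → n↭ , avoids-ps (allTriples-descending n↘)
         -- `applyDownFrom suc n` unfolds to `n` in front of `applyDownFrom suc n-1`. The second
         -- permutation moves that `n` to the end, and the head of `n↘` says that it exceeds the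
         -- rest.
         (there (here refl)) → ↭-trans (↭-sym (∷↭∷ʳ n (applyDownFrom suc n-1))) n↭
                             , avoids-ps (allTriples-∷ʳ (AllPairs.head n↘) (AllPairs.tail n↘))
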